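{- The mix rule $$\frac{\Delta\vdash\phi\qquad \Gamma[\phi]\cdots[\phi]\vdash\psi}{\Gamma[\Delta]\cdots[\Delta]\vdash\psi}\ (\mathrm{mix})$$ is admissible in the sequent calculus $\mathsf{G_{BDFNL}}$: if both premisses are derivable in $\mathsf{G_{BDFNL}}$, then so is the conclusion. Here $\Gamma[-]\cdots[-]$ is a context with one or more holes, and $\Gamma[\Delta]\cdots[\Delta]$ results from replacing the displayed occurrences of $\phi$ by $\Delta$.
   Context: $\mathcal{L}_{\mathrm{LC}}$-formulas are built from propositional variables and $\top,\bot$ using $\wedge,\vee,\to,\bullet,\leftarrow$. Structures: $\Gamma::=\phi\mid(\Gamma\odot\Gamma)\mid(\Gamma\barwedge\Gamma)$ with $\phi$ an $\mathcal{L}_{\mathrm{LC}}$-formula; $\odot$ and $\barwedge$ are structural operators for $\bullet$ and $\wedge$. A consecution is $\Gamma\vdash\phi$ with $\Gamma$ a structure and $\phi$ an $\mathcal{L}_{\mathrm{LC}}$-formula. A context $\Gamma[-]$ is a structure with a hole, and $\Gamma[\Delta]$ is the result of filling the hole with the structure $\Delta$ (similarly for contexts with several holes). $\mathsf{G_{BDFNL}}$ has: Axioms: $\phi\vdash\phi$; $\Gamma\vdash\top$; $\Gamma[\bot]\vdash\phi$. Logical rules: from $\Delta\vdash\phi$ and $\Gamma[\psi]\vdash\gamma$ infer $\Gamma[\Delta\odot(\phi\to\psi)]\vdash\gamma$; from $\phi\odot\Gamma\vdash\psi$ infer $\Gamma\vdash\phi\to\psi$; from $\Gamma[\phi]\vdash\gamma$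 and $\Delta\vdash\psi$ infer $\Gamma[(\phi\leftarrow\psi)\odot\Delta]\vdash\gamma$; from $\Gamma\odot\psi\vdash\phi$ infer $\Gamma\vdash\phi\leftarrow\psi$; from $\Gamma[\phi\odot\psi]\vdash\gamma$ infer $\Gamma[\phi\bullet\psi]\vdash\gamma$; from $\Gamma\vdash\phi$ and $\Delta\vdash\psi$ infer $\Gamma\odot\Delta\vdash\phi\bullet\psi$; from $\Gamma[\phi\barwedge\psi]\vdash\gamma$ infer $\Gamma[\phi\wedge\psi]\vdash\gamma$; from $\Gamma\vdash\phi$ and $\Delta\vdash\psi$ infer $\Gamma\barwedge\Delta\vdash\phi\wedge\psi$; from $\Gamma[\phi]\vdash\gamma$ and $\Gamma[\psi]\vdash\gamma$ infer $\Gamma[\phi\vee\psi]\vdash\gamma$; from $\Gamma\vdash\phi_i$ infer $\Gamma\vdash\phi_1\vee\phi_2$ ($i=1,2$). Structural rules: from $\Gamma[\Delta\barwedge\Delta]\vdash\phi$ infer $\Gamma[\Delta]\vdash\phi$; from $\Gamma[\Delta]\vdash\phi$ infer $\Gamma[\Sigma\barwedge\Delta]\vdash\phi$; from $\Gamma[\Delta\barwedge\Lambda]\vdash\phi$ infer $\Gamma[\Lambda\barwedge\Delta]\vdash\phi$; from $\Gamma[(\Delta_1\barwedge\Delta_2)\barwedge\Delta_3]\vdash\phi$ infer $\Gamma[\Delta_1\barwedge(\Delta_2\barwedge\Delta_3)]\vdash\phi$. -}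

module Defs where

open import Data.Nat using (ℕ; _+_)

infixr 7 _∧_ _•_
infixr 6 _∨_
infixr 5 _⇒_
infixl 5 _⇐_

-- _⇒_ and _⇐_ are the two residuals → and ← of _•_; the arrows
-- themselves are reserved symbols.
data Formula (Var : Set) : Set where
  var : Var → Formula Var
  ⊤ ⊥ : Formula Var
  _∧_ _∨_ _⇒_ _•_ _⇐_ : Formula Var → Formula Var → Formula Var

infixr 4 _⊙_ _⊼_

data Structure (Var : Set) : Set where
  ⟨_⟩     : Formula Var → Structure Var
  _⊙_ _⊼_ : Structure Var → Structure Var → Structure Var

-- Structures with exactly one hole; the superscript marks the side on which
-- the hole lies.
data Context (Var : Set) : Set where
  □         : Context Var
  _⊙ˡ_ _⊼ˡ_ : Context Var → Structure Var → Context Var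
  _⊙ʳ_ _⊼ʳ_ : Structure Var → Context Var → Context Var

infix 8 _[_]

_[_] : ∀ {Var} → Context Var → Structure Var → Structure Var
□        [ Δ ] = Δ
(Γ ⊙ˡ Σ) [ Δ ] = Γ [ Δ ] ⊙ Σ
(Γ ⊼ˡ Σ) [ Δ ] = Γ [ Δ ] ⊼ Σ
(Σ ⊙ʳ Γ) [ Δ ] = Σ ⊙ Γ [ Δ ]
(Σ ⊼ʳ Γ) [ Δ ] = Σ ⊼ Γ [ Δ ]

-- Structures with any number of holes, possibly none. A leaf ⟨ φ ⟩ is kept
-- under filling, so a context may mark only some of the occurrences of φ.
data MultiContext (Var : Set) : Set where
  □       : MultiContext Var
  ⟨_⟩     : Formula Var → MultiContext Var
  _⊙_ _⊼_ : MultiContext Var → MultiContext Var → MultiContext Var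

holes : ∀ {Var} → MultiContext Var → ℕ
holes □       = 1
holes ⟨ φ ⟩   = 0
holes (Γ ⊙ Σ) = holes Γ + holes Σ
holes (Γ ⊼ Σ) = holes Γ + holes Σ

infix 8 _[_]⋯[-]

-- Γ [ Δ ]⋯[-] puts Δ into every hole of Γ.
_[_]⋯[-] : ∀ {Var} → MultiContext Var → Structure Var → Structure Var
□       [ Δ ]⋯[-] = Δ
⟨ φ ⟩   [ Δ ]⋯[-] = ⟨ φ ⟩
(Γ ⊙ Σ) [ Δ ]⋯[-] = Γ [ Δ ]⋯[-] ⊙ Σ [ Δ ]⋯[-]
(Γ ⊼ Σ) [ Δ ]⋯[-] = Γ [ Δ ]⋯[-] ⊼ Σ [ Δ ]⋯[-]

infix 3 _⊢_

data _⊢_ {Var : Set} : Structure Var → Formula Var → Set where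
  ax : ∀ {φ} → ⟨ φ ⟩ ⊢ φ
  ⊤R : ∀ {Γ} → Γ ⊢ ⊤
  ⊥L : ∀ Γ {φ} → Γ [ ⟨ ⊥ ⟩ ] ⊢ φ

  ⇒L  : ∀ Γ {Δ φ ψ γ} → Δ ⊢ φ → Γ [ ⟨ ψ ⟩ ] ⊢ γ → Γ [ Δ ⊙ ⟨ φ ⇒ ψ ⟩ ] ⊢ γ
  ⇒R  : ∀ {Γ φ ψ} → ⟨ φ ⟩ ⊙ Γ ⊢ ψ → Γ ⊢ φ ⇒ ψ
  ⇐L  : ∀ Γ {Δ φ ψ γ} → Γ [ ⟨ φ ⟩ ] ⊢ γ → Δ ⊢ ψ → Γ [ ⟨ φ ⇐ ψ ⟩ ⊙ Δ ] ⊢ γ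
  ⇐R  : ∀ {Γ φ ψ} → Γ ⊙ ⟨ ψ ⟩ ⊢ φ → Γ ⊢ φ ⇐ ψ
  •L  : ∀ Γ {φ ψ γ} → Γ [ ⟨ φ ⟩ ⊙ ⟨ ψ ⟩ ] ⊢ γ → Γ [ ⟨ φ • ψ ⟩ ] ⊢ γ
  •R  : ∀ {Γ Δ φ ψ} → Γ ⊢ φ → Δ ⊢ ψ → Γ ⊙ Δ ⊢ φ • ψ
  ∧L  : ∀ Γ {φ ψ γ} → Γ [ ⟨ φ ⟩ ⊼ ⟨ ψ ⟩ ] ⊢ γ → Γ [ ⟨ φ ∧ ψ ⟩ ] ⊢ γ
  ∧R  : ∀ {Γ Δ φ ψ} → Γ ⊢ φ → Δ ⊢ ψ → Γ ⊼ Δ ⊢ φ ∧ ψ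
  ∨L  : ∀ Γ {φ ψ γ} → Γ [ ⟨ φ ⟩ ] ⊢ γ → Γ [ ⟨ ψ ⟩ ] ⊢ γ → Γ [ ⟨ φ ∨ ψ ⟩ ] ⊢ γ
  ∨R₁ : ∀ {Γ φ ψ} → Γ ⊢ φ → Γ ⊢ φ ∨ ψ
  ∨R₂ : ∀ {Γ φ ψ} → Γ ⊢ ψ → Γ ⊢ φ ∨ ψ

  contraction   : ∀ Γ {Δ φ} → Γ [ Δ ⊼ Δ ] ⊢ φ → Γ [ Δ ] ⊢ φ
  weakening     : ∀ Γ {Σ Δ φ} → Γ [ Δ ] ⊢ φ → Γ [ Σ ⊼ Δ ] ⊢ φ
  exchange      : ∀ Γ {Δ Λ φ} → Γ [ Δ ⊼ Λ ] ⊢ φ → Γ [ Λ ⊼ Δ ] ⊢ φ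
  associativity : ∀ Γ {Δ₁ Δ₂ Δ₃ φ} →
                  Γ [ (Δ₁ ⊼ Δ₂) ⊼ Δ₃ ] ⊢ φ → Γ [ Δ₁ ⊼ (Δ₂ ⊼ Δ₃) ] ⊢ φ

{-# OPTIONS --safe #-}
module Submission where

-- Mix is proved by induction on the mixed formula φ and, for a fixed φ, on the
-- derivation of the right premiss, in which any set of occurrences of φ may be
-- marked for replacement by Δ.  Marking a set rather than a single occurrence
-- is what lets contraction through: marks on the conclusion are copied to both
-- instances in the premiss (mix, split).
--
-- As long as no marked occurrence is principal, the last rule of the right
-- derivation is applied again after mixing its premisses.  When a marked φ is
-- principal, all other marked occurrences disappear by mixing the premisses, so
-- that Δ is wanted at just one place, C [ Δ ].  Only then is the derivation of
-- Δ ⊢ φ inspected: with a single hole, its left and structural rules can be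
-- replayed inside C, down to the sequents at which φ is introduced on the right
-- (permute).  There the two introductions of φ meet, and are replaced by cuts
-- on immediate subformulas of φ (the principal- lemmas).

open import Data.Nat using (_≤_)
open import Relation.Binary.PropositionalEquality using (_≡_; refl; cong; sym; subst)
open import Defs

-- Composition of contexts: the hole of the first is filled by the second.
infixr 9 _∘_

_∘_ : ∀ {Var} → Context Var → Context Var → Context Var
□        ∘ Γ = Γ
(C ⊙ˡ Σ) ∘ Γ = (C ∘ Γ) ⊙ˡ Σ
(C ⊼ˡ Σ) ∘ Γ = (C ∘ Γ) ⊼ˡ Σ
(Σ ⊙ʳ C) ∘ Γ = Σ ⊙ʳ (C ∘ Γ)
(Σ ⊼ʳ C) ∘ Γ = Σ ⊼ʳ (C ∘ Γ)

∘-fill : ∀ {Var} (C Γ : Context Var) {Δ} → (C ∘ Γ) [ Δ ] ≡ C [ Γ [ Δ ] ]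
∘-fill □        Γ = refl
∘-fill (C ⊙ˡ Σ) Γ = cong (_⊙ Σ) (∘-fill C Γ)
∘-fill (C ⊼ˡ Σ) Γ = cong (_⊼ Σ) (∘-fill C Γ)
∘-fill (Σ ⊙ʳ C) Γ = cong (Σ ⊙_) (∘-fill C Γ)
∘-fill (Σ ⊼ʳ C) Γ = cong (Σ ⊼_) (∘-fill C Γ)

module _ {Var : Set} where

  nest : ∀ (C Γ : Context Var) {Δ γ} → (C ∘ Γ) [ Δ ] ⊢ γ → C [ Γ [ Δ ] ] ⊢ γ
  nest C Γ = subst (_⊢ _) (∘-fill C Γ)

  unnest : ∀ (C Γ : Context Var) {Δ γ} → C [ Γ [ Δ ] ] ⊢ γ → (C ∘ Γ) [ Δ ] ⊢ γ
  unnest C Γ = subst (_⊢ _) (sym (∘-fill C Γ))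

  -- RightIntro Σ φ: the premisses of a derivation of Σ ⊢ φ whose last step is
  -- an axiom φ ⊢ φ or Γ ⊢ ⊤, or a right rule.
  data RightIntro : Structure Var → Formula Var → Set where
    ax  : ∀ {φ} → RightIntro ⟨ φ ⟩ φ
    ⊤R  : ∀ {Γ} → RightIntro Γ ⊤
    ⇒R  : ∀ {Γ φ ψ} → ⟨ φ ⟩ ⊙ Γ ⊢ ψ → RightIntro Γ (φ ⇒ ψ)
    ⇐R  : ∀ {Γ φ ψ} → Γ ⊙ ⟨ ψ ⟩ ⊢ φ → RightIntro Γ (φ ⇐ ψ)
    •R  : ∀ {Γ Δ φ ψ} → Γ ⊢ φ → Δ ⊢ ψ → RightIntro (Γ ⊙ Δ) (φ • ψ)
    ∧R  : ∀ {Γ Δ φ ψ} → Γ ⊢ φ → Δ ⊢ ψ → RightIntro (Γ ⊼ Δ) (φ ∧ ψ)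
    ∨R₁ : ∀ {Γ φ ψ} → Γ ⊢ φ → RightIntro Γ (φ ∨ ψ)
    ∨R₂ : ∀ {Γ φ ψ} → Γ ⊢ ψ → RightIntro Γ (φ ∨ ψ)

  -- Left and structural rules act inside an arbitrary context, so those that
  -- end a derivation of Δ ⊢ φ can be replayed below C.
  permute : ∀ (C : Context Var) {Δ φ γ} → Δ ⊢ φ →
            (∀ {Σ} → RightIntro Σ φ → C [ Σ ] ⊢ γ) → C [ Δ ] ⊢ γ
  permute C ax         k = k ax
  permute C ⊤R         k = k ⊤R
  permute C (⇒R d)     k = k (⇒R d)
  permute C (⇐R d)     k = k (⇐R d)
  permute C (•R d e)   k = k (•R d e)
  permute C (∧R d e)   k = k (∧R d e)
  permute C (∨R₁ d)    k = k (∨R₁ d)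
  permute C (∨R₂ d)    k = k (∨R₂ d)
  permute C (⊥L Γ)     k = nest C Γ (⊥L (C ∘ Γ))
  permute C (⇒L Γ d e) k = nest C Γ (⇒L (C ∘ Γ) d (unnest C Γ (permute C e k)))
  permute C (⇐L Γ d e) k = nest C Γ (⇐L (C ∘ Γ) (unnest C Γ (permute C d k)) e)
  permute C (•L Γ d)   k = nest C Γ (•L (C ∘ Γ) (unnest C Γ (permute C d k)))
  permute C (∧L Γ d)   k = nest C Γ (∧L (C ∘ Γ) (unnest C Γ (permute C d k)))
  permute C (∨L Γ d e) k = nest C Γ (∨L (C ∘ Γ) (unnest C Γ (permute C d k))
                                                (unnest C Γ (permute C e k)))
  permute C (contraction Γ d)   k =
    nest C Γ (contraction (C ∘ Γ) (unnest C Γ (permute C d k)))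
  permute C (weakening Γ d)     k =
    nest C Γ (weakening (C ∘ Γ) (unnest C Γ (permute C d k)))
  permute C (exchange Γ d)      k =
    nest C Γ (exchange (C ∘ Γ) (unnest C Γ (permute C d k)))
  permute C (associativity Γ d) k =
    nest C Γ (associativity (C ∘ Γ) (unnest C Γ (permute C d k)))

  -- Admissibility of single-hole cut on the formula φ.
  Cut : Formula Var → Set
  Cut φ = ∀ (C : Context Var) {Δ γ} → Δ ⊢ φ → C [ ⟨ φ ⟩ ] ⊢ γ → C [ Δ ] ⊢ γ

  -- ⊥ has no right rule, so permute leaves only the axiom ⊥ ⊢ ⊥ to consider.
  principal-⊥ : ∀ (C : Context Var) {Δ γ} → Δ ⊢ ⊥ → C [ Δ ] ⊢ γ
  principal-⊥ C δ = permute C δ λ { ax → ⊥L C }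

  -- In this and the following lemmas the cut formula is principal in the right
  -- premiss, and the arguments after the left premiss are the premisses of its left rule.
  -- Where permute reaches an axiom, that left rule itself is the answer.
  principal-⇒ : ∀ {α β} → Cut α → Cut β → ∀ C {Δ Λ γ} →
                Δ ⊢ α ⇒ β → Λ ⊢ α → C [ ⟨ β ⟩ ] ⊢ γ → C [ Λ ⊙ Δ ] ⊢ γ
  principal-⇒ cutα cutβ C {Λ = Λ} δ d e = nest C (Λ ⊙ʳ □) (permute (C ∘ (Λ ⊙ʳ □)) δ λ
    { ax     → unnest C (Λ ⊙ʳ □) (⇒L C d e)
    ; (⇒R f) → unnest C (Λ ⊙ʳ □) (cutβ C (cutα (□ ⊙ˡ _) d f) e) })

  principal-⇐ : ∀ {α β} → Cut α → Cut β → ∀ C {Δ Λ γ} →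
                Δ ⊢ α ⇐ β → C [ ⟨ α ⟩ ] ⊢ γ → Λ ⊢ β → C [ Δ ⊙ Λ ] ⊢ γ
  principal-⇐ cutα cutβ C {Λ = Λ} δ d e = nest C (□ ⊙ˡ Λ) (permute (C ∘ (□ ⊙ˡ Λ)) δ λ
    { ax     → unnest C (□ ⊙ˡ Λ) (⇐L C d e)
    ; (⇐R f) → unnest C (□ ⊙ˡ Λ) (cutα C (cutβ (_ ⊙ʳ □) e f) d) })

  principal-• : ∀ {α β} → Cut α → Cut β → ∀ C {Δ γ} →
                Δ ⊢ α • β → C [ ⟨ α ⟩ ⊙ ⟨ β ⟩ ] ⊢ γ → C [ Δ ] ⊢ γ
  principal-• {β = β} cutα cutβ C δ d = permute C δ λ
    { ax → •L C d
    ; (•R {Γ = Γ} f g) →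
        let Lβ = □ ⊙ˡ ⟨ β ⟩
            LΓ = Γ ⊙ʳ □
            d′ = nest C Lβ (cutα (C ∘ Lβ) f (unnest C Lβ d))
        in nest C LΓ (cutβ (C ∘ LΓ) g (unnest C LΓ d′)) }

  principal-∧ : ∀ {α β} → Cut α → Cut β → ∀ C {Δ γ} →
                Δ ⊢ α ∧ β → C [ ⟨ α ⟩ ⊼ ⟨ β ⟩ ] ⊢ γ → C [ Δ ] ⊢ γ
  principal-∧ {β = β} cutα cutβ C δ d = permute C δ λ
    { ax → ∧L C d
    ; (∧R {Γ = Γ} f g) →
        let Lβ = □ ⊼ˡ ⟨ β ⟩
            LΓ = Γ ⊼ʳ □
            d′ = nest C Lβ (cutα (C ∘ Lβ) f (unnest C Lβ d))
        in nest C LΓ (cutβ (C ∘ LΓ) g (unnest C LΓ d′)) }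

  principal-∨ : ∀ {α β} → Cut α → Cut β → ∀ C {Δ γ} →
                Δ ⊢ α ∨ β → C [ ⟨ α ⟩ ] ⊢ γ → C [ ⟨ β ⟩ ] ⊢ γ → C [ Δ ] ⊢ γ
  principal-∨ cutα cutβ C δ d e = permute C δ λ
    { ax      → ∨L C d e
    ; (∨R₁ f) → cutα C f d
    ; (∨R₂ f) → cutβ C f e }

  -- Replace φ Δ Γ Γ′: Γ′ arises from Γ by replacing some occurrences of the
  -- leaf φ by Δ.  A leaf φ may also be kept, so the relation records which
  -- occurrences are marked.
  data Replace (φ : Formula Var) (Δ : Structure Var) : Structure Var → Structure Var → Set where
    hit     : Replace φ Δ ⟨ φ ⟩ Δ
    keep    : ∀ {χ} → Replace φ Δ ⟨ χ ⟩ ⟨ χ ⟩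
    _⊙_     : ∀ {Γ Γ′ Σ Σ′} → Replace φ Δ Γ Γ′ → Replace φ Δ Σ Σ′ →
              Replace φ Δ (Γ ⊙ Σ) (Γ′ ⊙ Σ′)
    _⊼_     : ∀ {Γ Γ′ Σ Σ′} → Replace φ Δ Γ Γ′ → Replace φ Δ Σ Σ′ →
              Replace φ Δ (Γ ⊼ Σ) (Γ′ ⊼ Σ′)

  -- Split φ Δ Γ Σ Ξ: the structure Ξ, a replacement of Γ [ Σ ], is Γ′ [ Σ′ ]
  -- with Σ′ a replacement of Σ, and Γ′ a replacement of Γ in the sense that
  -- any other filling may be replaced along with it.
  data Split (φ : Formula Var) (Δ : Structure Var) (Γ : Context Var) (Σ : Structure Var) :
             Structure Var → Set where
    at : ∀ Γ′ {Σ′} → Replace φ Δ Σ Σ′ →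
         (∀ {Λ Λ′} → Replace φ Δ Λ Λ′ → Replace φ Δ (Γ [ Λ ]) (Γ′ [ Λ′ ])) →
         Split φ Δ Γ Σ (Γ′ [ Σ′ ])

  split : ∀ {φ Δ} Γ {Σ Ξ} → Replace φ Δ (Γ [ Σ ]) Ξ → Split φ Δ Γ Σ Ξ
  split □ r = at □ r (λ s → s)
  split (Γ ⊙ˡ Σ) (r ⊙ s) with split Γ r
  ... | at Γ′ t f = at (Γ′ ⊙ˡ _) t (λ u → f u ⊙ s)
  split (Γ ⊼ˡ Σ) (r ⊼ s) with split Γ r
  ... | at Γ′ t f = at (Γ′ ⊼ˡ _) t (λ u → f u ⊼ s)
  split (Σ ⊙ʳ Γ) (r ⊙ s) with split Γ s
  ... | at Γ′ t f = at (_ ⊙ʳ Γ′) t (λ u → r ⊙ f u)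
  split (Σ ⊼ʳ Γ) (r ⊼ s) with split Γ s
  ... | at Γ′ t f = at (_ ⊼ʳ Γ′) t (λ u → r ⊼ f u)

  replace-none : ∀ {φ Δ} Γ → Replace φ Δ Γ Γ
  replace-none ⟨ φ ⟩   = keep
  replace-none (Γ ⊙ Σ) = replace-none Γ ⊙ replace-none Σ
  replace-none (Γ ⊼ Σ) = replace-none Γ ⊼ replace-none Σ

  replace-hole : ∀ {φ Δ} (C : Context Var) → Replace φ Δ (C [ ⟨ φ ⟩ ]) (C [ Δ ])
  replace-hole □        = hit
  replace-hole (C ⊙ˡ Σ) = replace-hole C ⊙ replace-none Σ
  replace-hole (C ⊼ˡ Σ) = replace-hole C ⊼ replace-none Σ
  replace-hole (Σ ⊙ʳ C) = replace-none Σ ⊙ replace-hole C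
  replace-hole (Σ ⊼ʳ C) = replace-none Σ ⊼ replace-hole C

  replace-holes : ∀ {φ Δ} (Γ : MultiContext Var) →
                  Replace φ Δ (Γ [ ⟨ φ ⟩ ]⋯[-]) (Γ [ Δ ]⋯[-])
  replace-holes □       = hit
  replace-holes ⟨ χ ⟩   = keep
  replace-holes (Γ ⊙ Σ) = replace-holes Γ ⊙ replace-holes Σ
  replace-holes (Γ ⊼ Σ) = replace-holes Γ ⊼ replace-holes Σ

  cut : ∀ φ → Cut φ

  -- The recursion is lexicographic in φ and the right derivation: calls to cut
  -- descend to an immediate subformula of φ, while calls to mix keep φ and
  -- descend to a premiss.
  mix : ∀ φ {Δ Γ Γ′ γ} → Δ ⊢ φ → Replace φ Δ Γ Γ′ → Γ ⊢ γ → Γ′ ⊢ γ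

  cut φ C δ d = mix φ δ (replace-hole C) d

  mix φ δ r ax with r
  ... | hit  = δ
  ... | keep = ax
  mix φ δ r ⊤R = ⊤R
  mix φ δ r (⊥L Γ) with split Γ r
  ... | at Γ′ hit  _ = principal-⊥ Γ′ δ
  ... | at Γ′ keep _ = ⊥L Γ′
  mix φ δ r (⇒L Γ d e) with split Γ r
  ... | at Γ′ (s ⊙ hit)  f =
          principal-⇒ (cut _) (cut _) Γ′ δ (mix φ δ s d) (mix φ δ (f keep) e)
  ... | at Γ′ (s ⊙ keep) f = ⇒L Γ′ (mix φ δ s d) (mix φ δ (f keep) e)
  mix φ δ r (⇐L Γ d e) with split Γ r
  ... | at Γ′ (hit ⊙ s)  f =
          principal-⇐ (cut _) (cut _) Γ′ δ (mix φ δ (f keep) d) (mix φ δ s e)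
  ... | at Γ′ (keep ⊙ s) f = ⇐L Γ′ (mix φ δ (f keep) d) (mix φ δ s e)
  mix φ δ r (•L Γ d) with split Γ r
  ... | at Γ′ hit  f = principal-• (cut _) (cut _) Γ′ δ (mix φ δ (f (keep ⊙ keep)) d)
  ... | at Γ′ keep f = •L Γ′ (mix φ δ (f (keep ⊙ keep)) d)
  mix φ δ r (∧L Γ d) with split Γ r
  ... | at Γ′ hit  f = principal-∧ (cut _) (cut _) Γ′ δ (mix φ δ (f (keep ⊼ keep)) d)
  ... | at Γ′ keep f = ∧L Γ′ (mix φ δ (f (keep ⊼ keep)) d)
  mix φ δ r (∨L Γ d e) with split Γ r
  ... | at Γ′ hit  f =
          principal-∨ (cut _) (cut _) Γ′ δ (mix φ δ (f keep) d) (mix φ δ (f keep) e)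
  ... | at Γ′ keep f = ∨L Γ′ (mix φ δ (f keep) d) (mix φ δ (f keep) e)
  mix φ δ r (⇒R d)         = ⇒R (mix φ δ (keep ⊙ r) d)
  mix φ δ r (⇐R d)         = ⇐R (mix φ δ (r ⊙ keep) d)
  mix φ δ r (•R d e) with r
  ... | s ⊙ t = •R (mix φ δ s d) (mix φ δ t e)
  mix φ δ r (∧R d e) with r
  ... | s ⊼ t = ∧R (mix φ δ s d) (mix φ δ t e)
  mix φ δ r (∨R₁ d)        = ∨R₁ (mix φ δ r d)
  mix φ δ r (∨R₂ d)        = ∨R₂ (mix φ δ r d)
  mix φ δ r (contraction Γ d) with split Γ r
  ... | at Γ′ s f = contraction Γ′ (mix φ δ (f (s ⊼ s)) d)
  mix φ δ r (weakening Γ d) with split Γ r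
  ... | at Γ′ (_ ⊼ s) f = weakening Γ′ (mix φ δ (f s) d)
  mix φ δ r (exchange Γ d) with split Γ r
  ... | at Γ′ (s ⊼ t) f = exchange Γ′ (mix φ δ (f (t ⊼ s)) d)
  mix φ δ r (associativity Γ d) with split Γ r
  ... | at Γ′ (s ⊼ (t ⊼ u)) f = associativity Γ′ (mix φ δ (f ((s ⊼ t) ⊼ u)) d)

theorem10 : ∀ {Var : Set} (Γ : MultiContext Var) (Δ : Structure Var) (φ ψ : Formula Var) →
    1 ≤ holes Γ →
    Δ ⊢ φ →
    Γ [ ⟨ φ ⟩ ]⋯[-] ⊢ ψ →
    Γ [ Δ ]⋯[-] ⊢ ψ
theorem10 Γ Δ φ ψ _ δ d = mix φ δ (replace-holes Γ) d
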